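{- Let $G$ be a graph having neither an induced $C_4$ nor an induced $C_5$. Then $G\in \mathcal{F}(\vec{\mathcal{P}})$ if and only if $G$ is a comb.
   Context: Graphs and digraphs are finite; graphs are simple. An oriented graph is a digraph without loops, parallel arcs or digons (directed cycles of length 2). For a vertex $v$ of an oriented graph $D$, $N^{+}(v)$ is the set of out-neighbors of $v$, and $N^{++}(v)$ is the set of vertices at distance exactly 2 from $v$ (out-neighbors of out-neighbors of $v$, excluding $N^{+}(v)$). Write $x\rightarrow y$ if $(x,y)\in E(D)$. A missing edge of $D$ is an unordered pair $xy$ of distinct vertices with $(x,y)\notin E(D)$ and $(y,x)\notin E(D)$. $D$ is missing a graph $G$ if $V(G)\subseteq V(D)$ and $E(G)$ is exactly the set of missing edges of $D$ (isolated vertices of $G$ are allowed). A missing edge $e$ loses to a missing edge $e'$ if their endpoints can be labelled $e=x_1y_1$, $e'=x_2y_2$ so that $x_1\rightarrow x_2$, $y_2\notin N^{+}(x_1)\cup N^{++}(x_1)$, $y_1\rightarrow y_2$ and $x_2\notin N^{+}(y_1)\cup N^{++}(y_1)$. The dependency digraph $\Delta_D$ of $D$ has the missing edges of $D$ as vertices, with an arc $(e,e')$ if and only if $e$ loses to $e'$ (digons may occur in $\Delta_D$). For a family $\mathcal{H}$ of digraphs (digons allowed, taken up to isomorphism), $\mathcal{F}(\mathcal{H})$ is the set of graphs $G$ such that $\Delta_D\in\mathcal{H}$ for every oriented graph $D$ missing $G$. $\vec{\mathcal{P}}$ is the family of all digraphs consisting of vertex-disjoint directed paths only (a single vertex counts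 as a directed path; the digraph with no vertices is included). A chair is a graph on 5 distinct vertices $x,y,z,t,v$ whose edges are exactly $xy,yz,zt,zv$; the co-chair is its complement. $C_n$ is the cycle on $n$ vertices and $\overline{H}$ is the complement of $H$. A comb is a graph having no induced subgraph isomorphic to $C_4$, $\overline{C_4}$, $C_5$, chair or co-chair. -}

module Defs where

open import Level using (0ℓ; suc)
open import Data.Nat using (ℕ)
open import Data.Fin using (Fin; _<_)
open import Data.Fin.Patterns
open import Data.Fin.Properties using (_≟_; <-irrelevant)
open import Data.List using (List; []; _∷_; _++_; map; concat)
open import Data.List.NonEmpty using (List⁺; toList)
open import Data.List.Relation.Unary.Any using (Any)
open import Data.List.Relation.Unary.Unique.Propositional using (Unique)
import Data.List.Membership.Propositional as List
import Data.List.Membership.DecPropositional as DecList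
open import Data.Product using (_×_; _,_; ∃₂; Σ-syntax; ∃-syntax)
open import Data.Product.Properties using (≡-dec)
open import Data.Sum using (_⊎_; swap)
open import Function.Bundles using (_⇔_)
open import Function.Definitions using (Injective)
open import Relation.Binary
  using (Rel; Decidable; Symmetric; Irreflexive; Asymmetric)
open import Relation.Binary.PropositionalEquality using (_≡_; _≢_; refl; sym; cong)
open import Relation.Nullary using (¬_)
open import Relation.Nullary.Decidable using (¬?; _×-dec_; _⊎-dec_)
open import Relation.Unary using (Pred; _∈_; _∉_; _∪_)

record Graph : Set₁ where
  field
    order  : ℕ
    Adj    : Rel (Fin order) 0ℓ
    adj?   : Decidable Adj
    irrefl : Irreflexive _≡_ Adj
    symm   : Symmetric Adj

  V : Set
  V = Fin order

record OrientedGraph : Set₁ where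
  field
    order    : ℕ
    _⟶_      : Rel (Fin order) 0ℓ
    arc?     : Decidable _⟶_
    loopless : Irreflexive _≡_ _⟶_
    noDigon  : Asymmetric _⟶_

  V : Set
  V = Fin order

-- Loops and digons are allowed, and finiteness is not a field: the digraphs
-- built below have finite vertex types, and membership in 𝒫⃗ forces finiteness.
record Digraph : Set₁ where
  field
    Vertex : Set
    Arc    : Rel Vertex 0ℓ

fromEdges : (n : ℕ) → List (Fin n × Fin n) → Graph
fromEdges n es = record
  { order  = n
  ; Adj    = λ i j → i ≢ j × ((i , j) List.∈ es ⊎ (j , i) List.∈ es)
  ; adj?   = λ i j → ¬? (i ≟ j) ×-dec ((i , j) ∈? es ⊎-dec (j , i) ∈? es)
  ; irrefl = λ { i≡j (i≢j , _) → i≢j i≡j }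
  ; symm   = λ { (i≢j , e) → (λ j≡i → i≢j (sym j≡i)) , swap e }
  }
  where open DecList (≡-dec (_≟_ {n}) (_≟_ {n})) using (_∈?_)

complement : Graph → Graph
complement G = record
  { order  = order
  ; Adj    = λ i j → i ≢ j × ¬ Adj i j
  ; adj?   = λ i j → ¬? (i ≟ j) ×-dec ¬? (adj? i j)
  ; irrefl = λ { i≡j (i≢j , _) → i≢j i≡j }
  ; symm   = λ { (i≢j , ¬ij) → (λ j≡i → i≢j (sym j≡i)) , (λ ji → ¬ij (symm ji)) }
  }
  where open Graph G

C₄ : Graph
C₄ = fromEdges 4 ((0F , 1F) ∷ (1F , 2F) ∷ (2F , 3F) ∷ (3F , 0F) ∷ [])

C₅ : Graph
C₅ = fromEdges 5 ((0F , 1F) ∷ (1F , 2F) ∷ (2F , 3F) ∷ (3F , 4F) ∷ (4F , 0F) ∷ [])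

-- x, y, z, t, v = 0, 1, 2, 3, 4
chair : Graph
chair = fromEdges 5 ((0F , 1F) ∷ (1F , 2F) ∷ (2F , 3F) ∷ (2F , 4F) ∷ [])

infix 4 _InducedIn_

_InducedIn_ : Graph → Graph → Set
H InducedIn G =
  Σ[ f ∈ (V H → V G) ] Injective _≡_ _≡_ f × (∀ i j → Adj H i j ⇔ Adj G (f i) (f j))
  where open Graph

record Comb (G : Graph) : Set where
  field
    noC₄      : ¬ (C₄ InducedIn G)
    noCoC₄    : ¬ (complement C₄ InducedIn G)
    noC₅      : ¬ (C₅ InducedIn G)
    noChair   : ¬ (chair InducedIn G)
    noCoChair : ¬ (complement chair InducedIn G)

module _ (D : OrientedGraph) where
  open OrientedGraph D

  N⁺ : V → Pred V 0ℓ
  N⁺ x y = x ⟶ y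

  -- x itself is never in N⁺⁺ x, since D has no digon.
  N⁺⁺ : V → Pred V 0ℓ
  N⁺⁺ x y = y ∉ N⁺ x × ∃[ z ] z ∈ N⁺ x × y ∈ N⁺ z

  Missing : Rel V 0ℓ
  Missing x y = x ≢ y × ¬ (x ⟶ y) × ¬ (y ⟶ x)

  -- An unordered pair is represented by its increasing ordering, so that
  -- propositional equality is equality of unordered pairs (see missingEdge-≡).
  record MissingEdge : Set where
    constructor missingEdge
    field
      lo hi   : V
      lo<hi   : lo < hi
      missing : Missing lo hi

  open MissingEdge

  missingEdge-≡ : ∀ {e f} → lo e ≡ lo f → hi e ≡ hi f → e ≡ f
  missingEdge-≡ {missingEdge l h p m} {missingEdge _ _ q _} refl refl =
    cong (λ r → missingEdge l h r m) (<-irrelevant p q)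

  HasEnds : MissingEdge → V → V → Set
  HasEnds e x y = (lo e ≡ x × hi e ≡ y) ⊎ (lo e ≡ y × hi e ≡ x)

  LosesTo : Rel MissingEdge 0ℓ
  LosesTo e e′ =
    ∃₂ λ x₁ y₁ → ∃₂ λ x₂ y₂ →
      HasEnds e x₁ y₁ × HasEnds e′ x₂ y₂ ×
      (x₁ ⟶ x₂) × y₂ ∉ N⁺ x₁ ∪ N⁺⁺ x₁ ×
      (y₁ ⟶ y₂) × x₂ ∉ N⁺ y₁ ∪ N⁺⁺ y₁

  Δ : Digraph
  Δ = record { Vertex = MissingEdge ; Arc = LosesTo }

infix 4 _Misses_

-- V(G) ⊆ V(D) is given by an injection ι; vertices of D outside its image
-- lie on no missing edge.
_Misses_ : OrientedGraph → Graph → Set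
D Misses G =
  Σ[ ι ∈ (Graph.V G → OrientedGraph.V D) ] Injective _≡_ _≡_ ι ×
    (∀ x y → Missing D x y ⇔ (∃₂ λ a b → Graph.Adj G a b × ι a ≡ x × ι b ≡ y))

𝓕 : Pred Digraph 0ℓ → Pred Graph (suc 0ℓ)
𝓕 ℋ G = ∀ D → D Misses G → Δ D ∈ ℋ

Consecutive : {A : Set} → A → A → List⁺ A → Set
Consecutive u v p = ∃₂ λ xs ys → toList p ≡ xs ++ u ∷ v ∷ ys

-- A directed path is the nonempty list of its successive vertices. The listed
-- paths contain every vertex exactly once, and their steps are all the arcs.
𝒫⃗ : Pred Digraph 0ℓ
𝒫⃗ H =
  Σ[ ps ∈ List (List⁺ Vertex) ]
    let vs = concat (map toList ps) in
    Unique vs × (∀ v → v List.∈ vs) × (∀ u v → Arc u v ⇔ Any (Consecutive u v) ps)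
  where open Digraph H

{-# OPTIONS --safe #-}
-- If e = pq loses to e′, then, as C₄ and 2K₂ are excluded, the two edges are
-- the end edges of an induced P₄ p–q–q′–p′ of the missing graph, with
-- p → q′, q → p′, p′ → p, and there is no 2-path from p to p′ or from q to q′.
-- In a comb, p cannot also be the inner vertex of such a P₄ of pq, and two P₄s
-- sharing the end edge pq yield a third one on their other end edges. An arc,
-- in either direction, between an end of that third P₄ and its non-adjacent
-- inner vertex creates a forbidden 2-path, so degrees in Δ are at most 1; and
-- along a walk in Δ all later p′ dominate the first p, so there is no cycle.
-- Conversely 2K₂, the chair and the co-chair each have an orientation of their
-- complement whose Δ contains a digon, an out-degree 2 or an in-degree 2, and
-- this orientation extends to G.
module Submission where

open import Defs
open import Data.Bool using (if_then_else_)
open import Data.Empty using (⊥)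
open import Data.Fin using (Fin; zero; suc; _<_)
open import Data.Fin.Induction using (spo-wellFounded; spo-noetherian)
open import Data.Fin.Patterns
open import Data.Fin.Properties using (_≟_; _<?_; <-cmp; <-asym; any?; all?)
open import Data.List
  using (List; []; _∷_; _++_; _∷ʳ_; map; concat; concatMap; filter; deduplicate; length; lookup;
         allFin; cartesianProduct; tabulate)
open import Data.List.Membership.Propositional using (find; lose) renaming (_∈_ to _∈ₗ_)
open import Data.List.Membership.Propositional.Properties
  using (∈-++⁺ʳ; ∈-concat⁺′; ∈-concatMap⁺; ∈-map⁺; ∈-map⁻; ∈-filter⁺; ∈-deduplicate⁺;
         ∈-cartesianProduct⁺; ∈-allFin)
import Data.List.Membership.DecPropositional as DecMembership
open import Data.List.NonEmpty using (List⁺; toList; _∷_)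
open import Data.List.Properties using (++-assoc; ∷-injective; ∷ʳ-injectiveʳ)
open import Data.List.Relation.Binary.Disjoint.Propositional using (Disjoint)
open import Data.List.Relation.Unary.All as All using (All; []; _∷_)
import Data.List.Relation.Unary.All.Properties as All
open import Data.List.Relation.Unary.AllPairs using (AllPairs; []; _∷_)
import Data.List.Relation.Unary.Any as Any
open import Data.List.Relation.Unary.Any using (Any; here; there; index; satisfied)
open import Data.List.Relation.Unary.Any.Properties using (lookup-index)
open import Data.List.Relation.Unary.Unique.Propositional using (Unique)
open import Data.List.Relation.Unary.Unique.Propositional.Properties using (concat⁺)
import Data.List.Relation.Unary.Unique.DecPropositional.Properties as DecUnique
open import Data.Nat using (s≤s)
open import Data.Product using (_×_; _,_; ∃; ∃₂; ∃-syntax; proj₁; proj₂; swap)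
open import Data.Product.Properties using (≡-dec)
open import Data.Sum using (_⊎_; inj₁; inj₂)
import Data.Sum as Sum
import Data.Vec as Vec
open import Data.Vec using ([]; _∷_)
open import Function using (_∘_; flip; id)
open import Function.Bundles using (_⇔_; mk⇔; Equivalence)
open import Induction.WellFounded using (WellFounded; Acc; acc; module Subrelation)
open import Level using (0ℓ)
open import Relation.Binary
  using (Rel; Decidable; DecidableEquality; Asymmetric; IsStrictPartialOrder; tri<; tri≈; tri>)
open import Relation.Binary.Construct.Closure.ReflexiveTransitive using (Star; ε; _◅_; _◅◅_; reverse)
open import Relation.Binary.Construct.Closure.Transitive using (TransClosure; [_]; _∷_)
  renaming (_++_ to _⁺++_)
import Relation.Binary.Construct.On as On
open import Relation.Binary.PropositionalEquality
  using (_≡_; _≢_; refl; sym; trans; cong; subst; subst₂; isEquivalence; resp₂)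
open import Relation.Nullary using (¬_; Dec; does; yes; no; contradiction)
open import Relation.Nullary.Decidable using (¬?; _×-dec_; _⊎-dec_; _→-dec_; map′; True; toWitness)
open import Relation.Unary using (_∈_)

-- Neighbours in duplicate-free lists and local properties of path systems.

module _ {A : Set} where

  -- With no repetition `u` has a single position, so it cuts the list in one way only; two
  -- different cuts would put `u` in its own remainder.
  ++-∷-unique : ∀ {u : A} as {bs} as′ {bs′} → Unique (as ++ u ∷ bs) →
    as ++ u ∷ bs ≡ as′ ++ u ∷ bs′ → as ≡ as′ × bs ≡ bs′
  ++-∷-unique []       []         _        refl = refl , refl
  ++-∷-unique []       (_ ∷ as′) (u∉ ∷ _) refl =
    contradiction refl (All.lookup u∉ (∈-++⁺ʳ as′ (here refl)))
  ++-∷-unique (_ ∷ as) []        (a∉ ∷ _) refl =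
    contradiction refl (All.lookup a∉ (∈-++⁺ʳ as (here refl)))
  ++-∷-unique (_ ∷ as) (_ ∷ as′) (_ ∷ un) eq with refl , eq′ ← ∷-injective eq
    with refl , bs≡ ← ++-∷-unique as as′ un eq′ = refl , bs≡

  FollowedBy : List A → Rel A 0ℓ
  FollowedBy l u v = ∃₂ λ as bs → l ≡ as ++ u ∷ v ∷ bs

  module _ {l : List A} (un : Unique l) where

    followedBy-functional : ∀ {u v w} → FollowedBy l u v → FollowedBy l u w → v ≡ w
    followedBy-functional (as , _ , refl) (as′ , _ , eq) with ++-∷-unique as as′ un eq
    ... | _ , refl = refl

    private
      regroup : ∀ {u v} as {bs : List A} → l ≡ as ++ u ∷ v ∷ bs → l ≡ (as ∷ʳ u) ++ v ∷ bs
      regroup as eq = trans eq (sym (++-assoc as _ _))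

      prefixes : ∀ {v} as {bs : List A} as′ {bs′} →
        l ≡ as ++ v ∷ bs → l ≡ as′ ++ v ∷ bs′ → as ≡ as′ × bs ≡ bs′
      prefixes as as′ eq eq′ = ++-∷-unique as as′ (subst Unique eq un) (trans (sym eq) eq′)

    followedBy-injective : ∀ {u v w} → FollowedBy l u w → FollowedBy l v w → u ≡ v
    followedBy-injective (as , _ , eq) (as′ , _ , eq′) =
      ∷ʳ-injectiveʳ as as′ (proj₁ (prefixes _ _ (regroup as eq) (regroup as′ eq′)))

    followedBy-asym : ∀ {u v} → FollowedBy l u v → ¬ FollowedBy l v u
    followedBy-asym {u} (as , bs , eq) (as′ , bs′ , eq′)
      with prefixes (as ∷ʳ u) as′ (regroup as eq) eq′
    -- Cutting at `v` shows that `u` occurs again right after `v`; the two occurrences of `u` would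
    -- then have prefixes of different lengths.
    ... | _ , refl with ++-∷-unique as ((as ∷ʳ u) ∷ʳ _) (subst Unique eq un)
                       (trans (sym eq) (trans (regroup as eq) (sym (++-assoc (as ∷ʳ u) _ _))))
    ...   | as≡ , _ = unequal as as≡
      where
      unequal : ∀ {x y} (zs : List A) → ¬ zs ≡ (zs ∷ʳ x) ∷ʳ y
      unequal (_ ∷ zs) eq = unequal zs (proj₂ (∷-injective eq))

  -- Concatenation keeps all consecutive pairs and only adds some at the seams, so what holds in one
  -- duplicate-free list carries over to the arcs of the path system.
  followedBy-concat : ∀ {u v : A} {ps} → Any (Consecutive u v) ps →
    FollowedBy (concat (map toList ps)) u v
  followedBy-concat {ps = _ ∷ ps} (here (as , bs , eq)) =
    as , _ , trans (cong (_++ concat (map toList ps)) eq) (++-assoc as _ _)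
  followedBy-concat {ps = p ∷ _} (there c) with as , bs , eq ← followedBy-concat c =
    toList p ++ as , bs , trans (cong (toList p ++_) eq) (sym (++-assoc (toList p) as _))

-- The local consequences of `𝒫⃗` that the counterexamples violate: out-degree and in-degree at most
-- 1, and no digon.
record Linear (H : Digraph) : Set where
  open Digraph H
  field
    functional : ∀ {u v w} → Arc u v → Arc u w → v ≡ w
    injective  : ∀ {u v w} → Arc u w → Arc v w → u ≡ v
    asym       : ∀ {u v} → Arc u v → ¬ Arc v u

𝒫⃗⇒Linear : ∀ {H} → H ∈ 𝒫⃗ → Linear H
𝒫⃗⇒Linear {H} (ps , un , _ , arc⇔) = record
  { functional = λ a b → followedBy-functional un (step a) (step b)
  ; injective  = λ a b → followedBy-injective un (step a) (step b)
  ; asym       = λ a b → followedBy-asym un (step a) (step b)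
  }
  where
  step : ∀ {u v} → Digraph.Arc H u v → FollowedBy (concat (map toList ps)) u v
  step a = followedBy-concat (Equivalence.to (arc⇔ _ _) a)

-- Finite acyclic digraphs with all degrees at most 1 are unions of paths.

-- The paths are the maximal ones starting at the vertices without in-arc.
module PathDecomposition {Vertex : Set} {Arc : Rel Vertex 0ℓ}
  (vs : List Vertex) (complete : ∀ v → v ∈ₗ vs)
  (_≟_ : DecidableEquality Vertex) (arc? : Decidable Arc)
  (functional : ∀ {u v w} → Arc u v → Arc u w → v ≡ w)
  (injective  : ∀ {u v w} → Arc u w → Arc v w → u ≡ v)
  (acyclic    : ∀ {v} → ¬ TransClosure Arc v v)
  where

  private
    -- Acyclicity makes reachability a strict order. Carried over to positions in `vs`, it lives on
    -- a finite set, where strict orders are well-founded in both directions.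
    _⊏_ : Rel (Fin (length vs)) 0ℓ
    i ⊏ j = TransClosure Arc (lookup vs i) (lookup vs j)

    ⊏-isSPO : IsStrictPartialOrder _≡_ _⊏_
    ⊏-isSPO = record
      { isEquivalence = isEquivalence
      ; irrefl        = λ { refl → acyclic }
      ; trans         = _⁺++_
      ; <-resp-≈      = resp₂ _⊏_
      }

    code : Vertex → Fin (length vs)
    code v = index (complete v)

    Arc⇒⊏ : ∀ {u v} → Arc u v → code u ⊏ code v
    Arc⇒⊏ a = subst₂ (TransClosure Arc) (lookup-index (complete _)) (lookup-index (complete _)) [ a ]

  Arc-wellFounded : WellFounded Arc
  Arc-wellFounded = Subrelation.wellFounded Arc⇒⊏ (On.wellFounded code (spo-wellFounded ⊏-isSPO))

  Arc-noetherian : WellFounded (flip Arc)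
  Arc-noetherian = Subrelation.wellFounded Arc⇒⊏ (On.wellFounded code (spo-noetherian ⊏-isSPO))

  Source : Vertex → Set
  Source v = ∀ u → ¬ Arc u v

  -- Trail v xs: the maximal path from v visits v, then xs.
  data Trail : Vertex → List Vertex → Set where
    stop : ∀ {v} → (∀ w → ¬ Arc v w) → Trail v []
    step : ∀ {v w xs} → Arc v w → Trail w xs → Trail v (w ∷ xs)

  trail : ∀ v → ∃ (Trail v)
  trail v = go v (Arc-noetherian v)
    where
    go : ∀ v → Acc (flip Arc) v → ∃ (Trail v)
    go v (acc rs) with Any.any? (arc? v) vs
    ... | no ¬out = [] , stop λ w a → ¬out (lose (complete w) a)
    ... | yes out with w , a ← satisfied out with xs , t ← go w (rs a) = w ∷ xs , step a t

  trail-reaches : ∀ {v xs w} → Trail v xs → w ∈ₗ xs → TransClosure Arc v w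
  trail-reaches (step a _) (here refl) = [ a ]
  trail-reaches (step a t) (there w∈)  = a ∷ trail-reaches t w∈

  -- Out-degree at most 1 forces every walk from `v` to follow the trail, and the trail stops only
  -- where no arc leaves.
  reached-on-trail : ∀ {v xs w} → Trail v xs → Star Arc v w → w ∈ₗ v ∷ xs
  reached-on-trail _          ε       = here refl
  reached-on-trail (stop end) (b ◅ _) = contradiction b (end _)
  reached-on-trail (step a t) (b ◅ s) with refl ← functional a b =
    there (reached-on-trail t s)

  -- A repeated vertex on a trail would close a cycle.
  trail-unique : ∀ {v xs} → Trail v xs → Unique (v ∷ xs)
  trail-unique (stop _) = [] ∷ []
  trail-unique t@(step _ t′) =
    All.tabulate (λ { w∈ refl → acyclic (trail-reaches t w∈) }) ∷ trail-unique t′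

  trail-follows : ∀ {v xs u w} → Trail v xs → u ∈ₗ v ∷ xs → Arc u w → Consecutive u w (v ∷ xs)
  trail-follows (stop end) (here refl) b = contradiction b (end _)
  trail-follows (step a _) (here refl) b with refl ← functional a b = [] , _ , refl
  trail-follows {v} (step _ t) (there u∈) b with as , bs , eq ← trail-follows t u∈ b =
    v ∷ as , bs , cong (v ∷_) eq

  trail-arcs : ∀ {v xs u w} → Trail v xs → Consecutive u w (v ∷ xs) → Arc u w
  trail-arcs (stop _)   (_ ∷ [] , _ , ())
  trail-arcs (stop _)   (_ ∷ _ ∷ _ , _ , ())
  trail-arcs (step a _) ([] , _ , refl) = a
  trail-arcs (step _ t) (_ ∷ as , bs , eq) = trail-arcs t (as , bs , proj₂ (∷-injective eq))

  source-above : ∀ w → ∃[ v ] Source v × Star Arc v w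
  source-above w = go w (Arc-wellFounded w)
    where
    go : ∀ w → Acc Arc w → ∃[ v ] Source v × Star Arc v w
    go w (acc rs) with Any.any? (λ u → arc? u w) vs
    ... | no ¬in = w , (λ u a → ¬in (lose (complete u) a)) , ε
    ... | yes in′ with u , a ← satisfied in′ with v , src , s ← go u (rs a) = v , src , s ◅◅ (a ◅ ε)

  -- In-degree at most 1 makes the backward walk from `w` deterministic, and it can end only at a
  -- source. This makes the paths from distinct sources disjoint.
  source-unique : ∀ {v v′ w} → Source v → Source v′ → Star Arc v w → Star Arc v′ w → v ≡ v′
  source-unique src src′ s s′ = go src src′ (reverse (λ a → a) s) (reverse (λ a → a) s′)
    where
    go : ∀ {v v′ w} → Source v → Source v′ → Star (flip Arc) w v → Star (flip Arc) w v′ → v ≡ v′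
    go src src′ ε       ε       = refl
    go src src′ ε       (b ◅ _) = contradiction b (src _)
    go src src′ (a ◅ _) ε       = contradiction a (src′ _)
    go src src′ (a ◅ s) (b ◅ s′) with refl ← injective a b = go src src′ s s′

  path : Vertex → List⁺ Vertex
  path v = v ∷ proj₁ (trail v)

  ∈-path⇒Star : ∀ {v w} → w ∈ₗ toList (path v) → Star Arc v w
  ∈-path⇒Star (here refl) = ε
  ∈-path⇒Star {v} (there w∈) = star (trail-reaches (proj₂ (trail v)) w∈)
    where
    star : ∀ {u w} → TransClosure Arc u w → Star Arc u w
    star [ a ]    = a ◅ ε
    star (a ∷ as) = a ◅ star as

  paths-disjoint : ∀ {ss} → All Source ss → Unique ss →
    AllPairs Disjoint (map toList (map path ss))
  paths-disjoint []           []         = []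
  paths-disjoint {s ∷ _} (src ∷ srcs) (s∉ ∷ un) =
    All.map⁺ (All.map⁺ (All.zipWith (λ { (src′ , s≢) (w∈ , w∈′) →
      s≢ (source-unique src src′ (∈-path⇒Star w∈) (∈-path⇒Star w∈′)) }) (srcs , s∉)))
    ∷ paths-disjoint srcs un

  source? : ∀ v → Dec (Source v)
  source? v with Any.any? (λ u → arc? u v) vs
  ... | yes in′ = no λ src → let u , a = satisfied in′ in src u a
  ... | no ¬in  = yes λ u a → ¬in (lose (complete u) a)

  -- `vs` may list a vertex several times; a source listed twice would contribute its path twice.
  sources : List Vertex
  sources = deduplicate _≟_ (filter source? vs)

  ∈-sources : ∀ {v} → Source v → v ∈ₗ sources
  ∈-sources src = ∈-deduplicate⁺ _≟_ (∈-filter⁺ source? (complete _) src)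

  decomposition : record { Vertex = Vertex ; Arc = Arc } ∈ 𝒫⃗
  decomposition = map path sources
    , concat⁺ (All.map⁺ (All.map⁺ (All.universal (λ v → trail-unique (proj₂ (trail v))) sources)))
              (paths-disjoint (All.deduplicate⁺ _≟_ (All.all-filter source? vs))
                              (DecUnique.deduplicate-! _≟_ (filter source? vs)))
    , (λ w → let v , src , s = source-above w in
         ∈-concat⁺′ (reached-on-trail (proj₂ (trail v)) s)
                    (∈-map⁺ toList (∈-map⁺ path (∈-sources src))))
    , λ u w → mk⇔
        (λ a → let v , src , s = source-above u in
           lose (∈-map⁺ path (∈-sources src))
                (trail-follows (proj₂ (trail v)) (reached-on-trail (proj₂ (trail v)) s) a))
        (λ c → arc (find c))
    where
    arc : ∀ {u w} → ∃[ p ] p ∈ₗ map path sources × Consecutive u w p → Arc u w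
    arc (p , p∈ , c) with v , _ , refl ← ∈-map⁻ path p∈ = trail-arcs (proj₂ (trail v)) c

-- Induced copies from a table of pairs.

module _ (H G : Graph) (f : Graph.V H → Graph.V G) where
  private
    module H = Graph H
    module G = Graph G

  -- For a concrete `H` the test evaluates, so each pair asks exactly for adjacency in `G` or for
  -- adjacency in its complement. The rows above the diagonal suffice: symmetry gives the rest, and
  -- both alternatives force distinct images.
  Agree : Rel H.V 0ℓ
  Agree i j = if does (H.adj? i j) then G.Adj (f i) (f j) else (f i ≢ f j × ¬ G.Adj (f i) (f j))

  agree⇒induced : AllPairs Agree (allFin H.order) → H InducedIn G
  agree⇒induced agree = f , inj _ _ , iff
    where
    pairs : ∀ {n} {g : Fin n → H.V} → AllPairs Agree (tabulate g) → ∀ i j → i < j → Agree (g i) (g j)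
    pairs (p ∷ _)  zero    (suc j) _         = All.tabulate⁻ p j
    pairs (_ ∷ ps) (suc i) (suc j) (s≤s i<j) = pairs ps i j i<j

    Same : Rel H.V 0ℓ
    Same i j = (H.Adj i j × G.Adj (f i) (f j)) ⊎ (¬ H.Adj i j × f i ≢ f j × ¬ G.Adj (f i) (f j))

    same< : ∀ i j → i < j → Same i j
    same< i j i<j with H.adj? i j | pairs agree i j i<j
    ... | yes a | b = inj₁ (a , b)
    ... | no ¬a | b = inj₂ (¬a , b)

    same-sym : ∀ {i j} → Same i j → Same j i
    same-sym (inj₁ (a , b)) = inj₁ (H.symm a , G.symm b)
    same-sym (inj₂ (¬a , f≢ , ¬b)) = inj₂ (¬a ∘ H.symm , f≢ ∘ sym , ¬b ∘ G.symm)

    same : ∀ i j → i ≡ j ⊎ Same i j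
    same i j with <-cmp i j
    ... | tri< i<j _ _ = inj₂ (same< i j i<j)
    ... | tri≈ _ i≡j _ = inj₁ i≡j
    ... | tri> _ _ j<i = inj₂ (same-sym (same< j i j<i))

    inj : ∀ i j → f i ≡ f j → i ≡ j
    inj i j eq with same i j
    ... | inj₁ i≡j = i≡j
    ... | inj₂ (inj₁ (_ , b)) = contradiction b (G.irrefl eq)
    ... | inj₂ (inj₂ (_ , f≢ , _)) = contradiction eq f≢

    iff : ∀ i j → H.Adj i j ⇔ G.Adj (f i) (f j)
    iff i j with same i j
    ... | inj₁ refl = mk⇔ (λ a → contradiction a (H.irrefl refl)) (λ b → contradiction b (G.irrefl refl))
    ... | inj₂ (inj₁ (a , b)) = mk⇔ (λ _ → b) (λ _ → a)
    ... | inj₂ (inj₂ (¬a , _ , ¬b)) = mk⇔ (λ a → contradiction a ¬a) (λ b → contradiction b ¬b)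

-- Induced four-vertex paths in combs.

module InducedP₄ (G : Graph) where
  open Graph G

  infix 4 _~_ _≁_

  _~_ _≁_ : Rel V 0ℓ
  _~_ = Adj
  _≁_ = Graph.Adj (complement G)

  ≁-sym : ∀ {x y} → x ≁ y → y ≁ x
  ≁-sym = Graph.symm (complement G)

  record P₄ (p q r s : V) : Set where
    field
      pq : p ~ q
      qr : q ~ r
      rs : r ~ s
      pr : p ≁ r
      ps : p ≁ s
      qs : q ≁ s

  P₄-reverse : ∀ {p q r s} → P₄ p q r s → P₄ s r q p
  P₄-reverse P = record
    { pq = symm rs ; qr = symm qr ; rs = symm pq ; pr = ≁-sym qs ; ps = ≁-sym ps ; qs = ≁-sym pr }
    where open P₄ P

module CombP₄ (G : Graph) (comb : Comb G) where
  open Graph G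
  open Comb comb
  open InducedP₄ G

  apart : ∀ {x y z} → ¬ x ~ z → y ~ z → x ≢ y
  apart ¬xz yz refl = ¬xz yz

  C₄-free : ∀ {a b c d} → a ~ b → b ~ c → c ~ d → d ~ a → a ≁ c → b ≁ d → ⊥
  C₄-free {a} {b} {c} {d} ab bc cd da ac bd =
    noC₄ (agree⇒induced C₄ G (Vec.lookup (a ∷ b ∷ c ∷ d ∷ []))
      ((ab ∷ ac ∷ symm da ∷ []) ∷ (bc ∷ bd ∷ []) ∷ (cd ∷ []) ∷ [] ∷ []))

  2K₂-free : ∀ {a b c d} → a ~ b → c ~ d → a ≁ c → a ≁ d → b ≁ c → b ≁ d → ⊥
  2K₂-free {a} {b} {c} {d} ab cd ac ad bc bd =
    -- The complement of the 4-cycle 0, 1, 2, 3 has edges 02 and 13, whence the order `a`, `c`, `b`,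
    -- `d`.
    noCoC₄ (agree⇒induced (complement C₄) G (Vec.lookup (a ∷ c ∷ b ∷ d ∷ []))
      ((ac ∷ ab ∷ ad ∷ []) ∷ (≁-sym bc ∷ cd ∷ []) ∷ (bd ∷ []) ∷ [] ∷ []))

  C₅-free : ∀ {p q r s t} → P₄ p q r s → s ~ t → t ~ p → q ≁ t → r ≁ t → ⊥
  C₅-free {p} {q} {r} {s} {t} P st tp qt rt =
    noC₅ (agree⇒induced C₅ G (Vec.lookup (p ∷ q ∷ r ∷ s ∷ t ∷ []))
      ((pq ∷ pr ∷ ps ∷ symm tp ∷ []) ∷ (qr ∷ qs ∷ qt ∷ []) ∷ (rs ∷ rt ∷ []) ∷ (st ∷ []) ∷ [] ∷ []))
    where open P₄ P

  chair-free : ∀ {p q r s v} → P₄ p q r s → r ~ v → p ≁ v → q ≁ v → s ≁ v → ⊥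
  chair-free {p} {q} {r} {s} {v} P rv pv qv sv =
    noChair (agree⇒induced chair G (Vec.lookup (p ∷ q ∷ r ∷ s ∷ v ∷ []))
      ((pq ∷ pr ∷ ps ∷ pv ∷ []) ∷ (qr ∷ qs ∷ qv ∷ []) ∷ (rs ∷ rv ∷ []) ∷ (sv ∷ []) ∷ [] ∷ []))
    where open P₄ P

  coChair-free : ∀ {p q r s v} → P₄ p q r s → p ~ v → q ~ v → r ~ v → s ≁ v → ⊥
  coChair-free {p} {q} {r} {s} {v} P pv qv rv sv =
    -- The non-edges `rp`, `ps`, `sq`, `sv` form a chair branching at `s`.
    noCoChair (agree⇒induced (complement chair) G (Vec.lookup (r ∷ p ∷ s ∷ q ∷ v ∷ []))
      ((≁-sym pr ∷ rs ∷ symm qr ∷ rv ∷ []) ∷ (ps ∷ pq ∷ pv ∷ []) ∷ (≁-sym qs ∷ sv ∷ [])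
        ∷ (qv ∷ []) ∷ [] ∷ []))
    where open P₄ P

  -- A neighbour `t` of the end `s` that escapes `r` closes a C₄ if it sees `q`, a C₅ if it sees `p`
  -- but not `q`, and otherwise leaves `pq` and `st` as a 2K₂.
  end-dominated : ∀ {p q r s t} → P₄ p q r s → s ~ t → ¬ r ≁ t
  end-dominated {p} {q} {r} {s} {t} P st rt with adj? q t | adj? p t
  ... | yes qt | _ = C₄-free qr rs st (symm qt) qs rt
    where open P₄ P
  ... | no ¬qt | yes pt = C₅-free P st (symm pt) (q≢t , ¬qt) rt
    where
    open P₄ P
    q≢t : q ≢ t
    q≢t = apart (proj₂ qs) (symm st)
  ... | no ¬qt | no ¬pt =
    2K₂-free pq st ps (apart (proj₂ ps) (symm st) , ¬pt) qs (apart (proj₂ qs) (symm st) , ¬qt)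
    where open P₄ P

  private
    -- If `s` saw `r′`, the five vertices would induce a co-chair when `r` and `r′` are adjacent,
    -- and `q`, `r`, `s`, `r′` a C₄ when they are not.
    no-crossing : ∀ {p q r s r′} → P₄ p q r s → q ~ r′ → p ≁ r′ → r ≢ r′ → ¬ s ~ r′
    no-crossing {r = r} {r′ = r′} P qr′ pr′ r≢r′ sr′ with adj? r r′
    ... | yes rr′ = coChair-free (P₄-reverse P) sr′ rr′ qr′ pr′
    ... | no ¬rr′ = C₄-free qr rs sr′ (symm qr′) qs (r≢r′ , ¬rr′)
      where open P₄ P

  -- If `r` and `r′` coincide, `s` and `s′` are two leaves there and give a chair. Otherwise
  -- `no-crossing` excludes the cross edges, an edge `ss′` would form a 2K₂ with `pq`, and then `r`
  -- and `r′` must be adjacent lest `rs` and `r′s′` form a 2K₂.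
  P₄-extend : ∀ {p q r s r′ s′} → P₄ p q r s → P₄ p q r′ s′ → (s , r) ≢ (s′ , r′) → P₄ s r r′ s′
  P₄-extend {p} {q} {r} {s} {r′} {s′} P P′ ≢′ with r ≟ r′
  ... | yes refl = contradiction (s≢s′ , ¬ss′) (chair-free P P′.rs P′.ps P′.qs)
    where
    module P = P₄ P
    module P′ = P₄ P′
    s≢s′ : s ≢ s′
    s≢s′ refl = ≢′ refl
    ¬ss′ : ¬ s ~ s′
    ¬ss′ ss′ = 2K₂-free P.pq ss′ P.ps P′.ps P.qs P′.qs
  ... | no r≢r′ = record
    { pq = symm P.rs ; qr = rr′ ; rs = P′.rs ; pr = sr′ ; ps = ss′ ; qs = ≁-sym s′r }
    where
    module P = P₄ P
    module P′ = P₄ P′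
    sr′ : s ≁ r′
    sr′ = apart (proj₂ P.qs ∘ symm) (symm P′.qr) , no-crossing P P′.qr P′.pr r≢r′
    s′r : s′ ≁ r
    s′r = apart (proj₂ P′.qs ∘ symm) (symm P.qr) , no-crossing P′ P.qr P.pr (r≢r′ ∘ sym)
    ss′ : s ≁ s′
    ss′ = apart (proj₂ sr′) (symm P′.rs) , λ ss′ → 2K₂-free P.pq ss′ P.ps P′.ps P.qs P′.qs
    rr′ : r ~ r′
    rr′ with adj? r r′
    ... | yes a = a
    ... | no ¬a = contradiction ss′ (2K₂-free P.rs P′.rs (r≢r′ , ¬a) (≁-sym s′r) sr′)

-- The missing graph of an oriented graph and the enumeration of its edges.

module MissingGraph (D : OrientedGraph) where
  open OrientedGraph D
  open MissingEdge

  missing? : Decidable (Missing D)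
  missing? x y = ¬? (x ≟ y) ×-dec ¬? (arc? x y) ×-dec ¬? (arc? y x)

  missingGraph : Graph
  missingGraph = record
    { order  = order
    ; Adj    = Missing D
    ; adj?   = missing?
    ; irrefl = λ { x≡y (x≢y , _) → x≢y x≡y }
    ; symm   = λ { (x≢y , a , b) → x≢y ∘ sym , b , a }
    }

  ends-missing : ∀ {e x y} → HasEnds D e x y → Missing D x y
  ends-missing {e} (inj₁ (refl , refl)) = missing e
  ends-missing {e} (inj₂ (refl , refl)) = Graph.symm missingGraph (missing e)

  ends-unique : ∀ {e x y x′ y′} → HasEnds D e x y → HasEnds D e x′ y′ →
    (x , y) ≡ (x′ , y′) ⊎ (y , x) ≡ (x′ , y′)
  ends-unique (inj₁ (refl , refl)) (inj₁ (refl , refl)) = inj₁ refl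
  ends-unique (inj₁ (refl , refl)) (inj₂ (refl , refl)) = inj₂ refl
  ends-unique (inj₂ (refl , refl)) (inj₁ (refl , refl)) = inj₂ refl
  ends-unique (inj₂ (refl , refl)) (inj₂ (refl , refl)) = inj₁ refl

  edge-unique : ∀ {e e′ x y} → HasEnds D e x y → HasEnds D e′ x y → e ≡ e′
  edge-unique (inj₁ (a , b)) (inj₁ (c , d)) = missingEdge-≡ D (trans a (sym c)) (trans b (sym d))
  edge-unique (inj₂ (a , b)) (inj₂ (c , d)) = missingEdge-≡ D (trans a (sym c)) (trans b (sym d))
  edge-unique {e} {e′} (inj₁ (refl , refl)) (inj₂ (refl , refl)) =
    contradiction (lo<hi e′) (<-asym (lo<hi e))
  edge-unique {e} {e′} (inj₂ (refl , refl)) (inj₁ (refl , refl)) =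
    contradiction (lo<hi e′) (<-asym (lo<hi e))

  edgeBetween : ∀ x y → Missing D x y → ∃[ e ] HasEnds D e x y
  edgeBetween x y m with <-cmp x y
  ... | tri< x<y _ _ = missingEdge x y x<y m , inj₁ (refl , refl)
  ... | tri≈ _ x≡y _ = contradiction x≡y (proj₁ m)
  ... | tri> _ _ y<x = missingEdge y x y<x (Graph.symm missingGraph m) , inj₂ (refl , refl)

  edge-≟ : DecidableEquality (MissingEdge D)
  edge-≟ e e′ = map′ (λ (a , b) → missingEdge-≡ D a b) (λ { refl → refl , refl })
                     (lo e ≟ lo e′ ×-dec hi e ≟ hi e′)

  private
    edgesOn : V × V → List (MissingEdge D)
    edgesOn (x , y) with x <? y ×-dec missing? x y
    ... | yes (x<y , m) = missingEdge x y x<y m ∷ []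
    ... | no _          = []

    ∈-edgesOn : ∀ e → e ∈ₗ edgesOn (lo e , hi e)
    ∈-edgesOn e with lo e <? hi e ×-dec missing? (lo e) (hi e)
    ... | yes _ = here (missingEdge-≡ D refl refl)
    ... | no ¬e = contradiction (lo<hi e , missing e) ¬e

  edges : List (MissingEdge D)
  edges = concatMap edgesOn (cartesianProduct (allFin order) (allFin order))

  ∈-edges : ∀ e → e ∈ₗ edges
  ∈-edges e = ∈-concatMap⁺ edgesOn
    (lose (∈-cartesianProduct⁺ (∈-allFin (lo e)) (∈-allFin (hi e))) (∈-edgesOn e))

  losesTo? : Decidable (LosesTo D)
  losesTo? e e′ = any? λ x₁ → any? λ y₁ → any? λ x₂ → any? λ y₂ →
    ends? e x₁ y₁ ×-dec ends? e′ x₂ y₂ ×-dec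
    arc? x₁ x₂ ×-dec ¬? (within2? x₁ y₂) ×-dec
    arc? y₁ y₂ ×-dec ¬? (within2? y₁ x₂)
    where
    ends? : ∀ e x y → Dec (HasEnds D e x y)
    ends? e x y = (lo e ≟ x ×-dec hi e ≟ y) ⊎-dec (lo e ≟ y ×-dec hi e ≟ x)
    within2? : ∀ x y → Dec (N⁺ D x y ⊎ N⁺⁺ D x y)
    within2? x y = arc? x y ⊎-dec (¬? (arc? x y) ×-dec any? λ z → arc? x z ×-dec arc? z y)

-- The dependency digraph when the missing graph is a comb.

module CombDependency (D : OrientedGraph) (comb : Comb (MissingGraph.missingGraph D)) where
  open OrientedGraph D
  open MissingGraph D
  open InducedP₄ missingGraph
  open CombP₄ missingGraph comb

  -- The first component is the end (tip) of the P₄s that the missing edge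
  -- terminates, the second the inner vertex (base).
  Tooth : Set
  Tooth = V × V

  tip base : Tooth → V
  tip  = proj₁
  base = proj₂

  Ends : MissingEdge D → Tooth → Set
  Ends e t = HasEnds D e (tip t) (base t)

  infix 4 _∼_ _⊳_

  _∼_ : Rel Tooth 0ℓ
  t ∼ u = P₄ (tip t) (base t) (base u) (tip u)

  ∼-extend : ∀ {t u w} → t ∼ u → t ∼ w → u ≢ w → u ∼ w
  ∼-extend = P₄-extend

  -- The second P₄ would continue from `tip t` to a vertex not adjacent to `base t`, against
  -- `end-dominated` at the end `tip t` of the first.
  ¬∼-swap : ∀ {t u w} → t ∼ u → ¬ swap t ∼ w
  ¬∼-swap P Q = end-dominated (P₄-reverse P) (P₄.qr Q) (P₄.pr Q)

  -- A missing edge thus has one tooth, whichever P₄ reveals it, so arcs of Δ sharing an edge can be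
  -- compared as relations between teeth.
  same-tooth : ∀ {e t t′ u w} → Ends e t → Ends e t′ → t ∼ u → t′ ∼ w → t ≡ t′
  same-tooth {e} te te′ P Q with ends-unique {e} te te′
  ... | inj₁ t≡t′ = t≡t′
  ... | inj₂ refl = contradiction Q (¬∼-swap P)

  -- Losing, read along the P₄. The last two fields forbid 2-paths; direct arcs are already
  -- excluded, between the tips by `tip⟵tip` and between the bases because that pair is missing.
  record _⊳_ (t u : Tooth) : Set where
    field
      mates     : t ∼ u
      tip⟶base  : tip t ⟶ base u
      base⟶tip  : base t ⟶ tip u
      tip⟵tip   : tip u ⟶ tip t
      tip↛tip   : ∀ {z} → tip t ⟶ z → ¬ z ⟶ tip u
      base↛base : ∀ {z} → base t ⟶ z → ¬ z ⟶ base u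

  private
    arc⇒≁ : ∀ {x y} → x ⟶ y → x ≁ y
    arc⇒≁ a = (λ x≡y → loopless x≡y a) , λ (_ , ¬a , _) → ¬a a

    ≁⇒arc : ∀ {x y} → x ≁ y → x ⟶ y ⊎ y ⟶ x
    ≁⇒arc {x} {y} (x≢y , ¬m) with arc? x y | arc? y x
    ... | yes a | _     = inj₁ a
    ... | no _  | yes b = inj₂ b
    ... | no ¬a | no ¬b = contradiction (x≢y , ¬a , ¬b) ¬m

    Near : Rel V 0ℓ
    Near x y = N⁺ D x y ⊎ N⁺⁺ D x y

    no-2-path : ∀ {x y z} → ¬ Near x y → x ⟶ z → ¬ z ⟶ y
    no-2-path far a b = far (inj₂ (far ∘ inj₁ , _ , a , b))

    P₄⇒⊳ : ∀ {x₁ y₁ x₂ y₂} → Missing D x₁ y₁ → Missing D x₂ y₂ →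
      x₁ ⟶ x₂ → ¬ Near x₁ y₂ → y₁ ⟶ y₂ → ¬ Near y₁ x₂ →
      y₁ ~ x₂ → x₁ ≁ y₂ → (x₁ , y₁) ⊳ (y₂ , x₂)
    P₄⇒⊳ m₁ m₂ a far b far′ yx xy = record
      { mates     = record { pq = m₁ ; qr = yx ; rs = m₂ ; pr = arc⇒≁ a ; ps = xy ; qs = arc⇒≁ b }
      ; tip⟶base  = a
      ; base⟶tip  = b
      ; tip⟵tip   = Sum.[ (λ c → contradiction (inj₁ c) far) , id ] (≁⇒arc xy)
      ; tip↛tip   = no-2-path far
      ; base↛base = no-2-path far′
      }

  -- The two given arcs leave open only the cross pairs `x₁y₂` and `y₁x₂`. Both missing gives a C₄,
  -- neither a 2K₂; exactly one missing is the middle edge of a P₄, and which one decides the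
  -- labelling.
  losesTo⇒⊳ : ∀ {e e′} → LosesTo D e e′ → ∃₂ λ t u → Ends e t × Ends e′ u × t ⊳ u
  losesTo⇒⊳ {e} {e′} (x₁ , y₁ , x₂ , y₂ , ends , ends′ , a , far , b , far′)
    with missing? x₁ y₂ | missing? y₁ x₂
  ... | no ¬xy | yes yx =
    (x₁ , y₁) , (y₂ , x₂) , ends , Sum.swap ends′ ,
    P₄⇒⊳ (ends-missing {e} ends) (ends-missing {e′} ends′) a far b far′ yx
      -- Were `x₁` equal to `y₂`, the arc `b` would join the ends of the missing edge `e`.
      ((λ { refl → proj₂ (proj₂ (ends-missing {e} ends)) b }) , ¬xy)
  ... | yes xy | no ¬yx =
    (y₁ , x₁) , (x₂ , y₂) , Sum.swap ends , ends′ ,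
    P₄⇒⊳ (ends-missing {e} (Sum.swap ends)) (ends-missing {e′} (Sum.swap ends′)) b far′ a far xy
      ((λ { refl → proj₁ (proj₂ (ends-missing {e} ends)) a }) , ¬yx)
  ... | yes xy | yes yx = contradiction (arc⇒≁ b)
    (C₄-free (ends-missing {e} ends) yx (ends-missing {e′} ends′) (Graph.symm missingGraph xy) (arc⇒≁ a))
  ... | no ¬xy | no ¬yx = contradiction (arc⇒≁ b)
    (2K₂-free (ends-missing {e} ends) (ends-missing {e′} ends′) (arc⇒≁ a)
      ((λ { refl → proj₂ (proj₂ (ends-missing {e} ends)) b }) , ¬xy)
      ((λ { refl → proj₁ (proj₂ (ends-missing {e} ends)) a }) , ¬yx))

  private
    tooth-≟ : DecidableEquality Tooth
    tooth-≟ = ≡-dec _≟_ _≟_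

  -- If `u` and `w` differ, `base u` and `tip w` are joined by an arc. One direction gives a 2-path
  -- from `tip t` to `tip w`, the other one from `base t` to `base u`.
  ⊳-functional : ∀ {t u w} → t ⊳ u → t ⊳ w → u ≡ w
  ⊳-functional {t} {u} {w} t⊳u t⊳w with tooth-≟ u w
  ... | yes u≡w = u≡w
  ... | no u≢w
    with ≁⇒arc (P₄.qs (∼-extend (_⊳_.mates t⊳u) (_⊳_.mates t⊳w) u≢w))
  ...   | inj₁ a = contradiction a (_⊳_.tip↛tip t⊳w (_⊳_.tip⟶base t⊳u))
  ...   | inj₂ a = contradiction a (_⊳_.base↛base t⊳u (_⊳_.base⟶tip t⊳w))

  -- Dually, the arc between `tip u` and `base w` yields a 2-path from `tip u` to `tip t` or from
  -- `base w` to `base t`.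
  ⊳-injective : ∀ {t u w} → u ⊳ t → w ⊳ t → u ≡ w
  ⊳-injective {t} {u} {w} u⊳t w⊳t with tooth-≟ u w
  ... | yes u≡w = u≡w
  ... | no u≢w
    with ≁⇒arc (P₄.pr (∼-extend (P₄-reverse (_⊳_.mates u⊳t)) (P₄-reverse (_⊳_.mates w⊳t)) u≢w))
  ...   | inj₁ a = contradiction (_⊳_.base⟶tip w⊳t) (_⊳_.tip↛tip u⊳t a)
  ...   | inj₂ a = contradiction (_⊳_.tip⟶base u⊳t) (_⊳_.base↛base w⊳t a)

  losesTo-functional : ∀ {e f g} → LosesTo D e f → LosesTo D e g → f ≡ g
  losesTo-functional {e} {f} {g} l l′
    with t , u , te , uf , t⊳u ← losesTo⇒⊳ {e} {f} l
    with t′ , w , te′ , wg , t⊳w ← losesTo⇒⊳ {e} {g} l′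
    with refl ← same-tooth {e} te te′ (_⊳_.mates t⊳u) (_⊳_.mates t⊳w)
    with refl ← ⊳-functional t⊳u t⊳w = edge-unique uf wg

  losesTo-injective : ∀ {e f g} → LosesTo D e g → LosesTo D f g → e ≡ f
  losesTo-injective {e} {f} {g} l l′
    with u , t , ue , tg , u⊳t ← losesTo⇒⊳ {e} {g} l
    with w , t′ , wf , tg′ , w⊳t ← losesTo⇒⊳ {f} {g} l′
    with refl ← same-tooth {g} tg tg′ (P₄-reverse (_⊳_.mates u⊳t)) (P₄-reverse (_⊳_.mates w⊳t))
    with refl ← ⊳-injective u⊳t w⊳t = edge-unique ue wf

  -- Were the arc between the tips of the first and last tooth reversed, it
  -- would give a 2-path between the tips of the first two.
  losesTo⁺⇒tips : ∀ {e f} → TransClosure (LosesTo D) e f →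
    ∃₂ λ t u → Ends e t × Ends f u × t ∼ u × tip u ⟶ tip t
  losesTo⁺⇒tips {e} {f} [ l ] with t , u , te , uf , t⊳u ← losesTo⇒⊳ {e} {f} l =
    t , u , te , uf , _⊳_.mates t⊳u , _⊳_.tip⟵tip t⊳u
  losesTo⁺⇒tips {e} {f} (_∷_ {y = g} l ls)
    with t , w , te , wg , t⊳w ← losesTo⇒⊳ {e} {g} l
    with w′ , u , wg′ , uf , w∼u , back ← losesTo⁺⇒tips ls
    with refl ← same-tooth {g} wg wg′ (P₄-reverse (_⊳_.mates t⊳w)) w∼u
    with tooth-≟ t u
  -- A return to the first tooth would put opposite arcs between the tips of `t` and `w`.
  ... | yes refl = contradiction back (noDigon (_⊳_.tip⟵tip t⊳w))
  ... | no t≢u = t , u , te , uf , t∼u ,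
    Sum.[ (λ a → contradiction back (_⊳_.tip↛tip t⊳w a)) , id ] (≁⇒arc (P₄.ps t∼u))
    where
    t∼u : t ∼ u
    t∼u = ∼-extend (P₄-reverse (_⊳_.mates t⊳w)) w∼u t≢u

  -- On a closed walk the first and last teeth coincide, so the arc between their tips is a loop.
  losesTo-acyclic : ∀ {e} → ¬ TransClosure (LosesTo D) e e
  losesTo-acyclic {e} ls with t , u , te , ue , t∼u , a ← losesTo⁺⇒tips ls
    with refl ← same-tooth {e} te ue t∼u (P₄-reverse t∼u) = loopless refl a

  Δ-paths : Δ D ∈ 𝒫⃗
  Δ-paths = PathDecomposition.decomposition edges ∈-edges edge-≟ losesTo?
    (λ {e} {f} {g} → losesTo-functional {e} {f} {g})
    (λ {e} {f} {g} → losesTo-injective {e} {f} {g}) losesTo-acyclic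

-- From induced subgraphs of the missing graph to those of `G`.

NoIsolated : Graph → Set
NoIsolated H = ∀ i → ∃[ j ] Graph.Adj H i j

noIsolated? : ∀ H → Dec (NoIsolated H)
noIsolated? H = all? λ i → any? (Graph.adj? H i)

module _ {D G} (misses : D Misses G) where
  open MissingGraph D
  open Equivalence

  private
    ι = proj₁ misses
    ι-injective = proj₁ (proj₂ misses)
    missing⇔ = proj₂ (proj₂ misses)

  -- Vertices of `D` outside the image of `ι` are isolated in the missing graph, so a copy of a
  -- graph with no isolated vertex lies within the image.
  induced-missing⇒induced : ∀ {H} → NoIsolated H → H InducedIn missingGraph → H InducedIn G
  induced-missing⇒induced {H} noIso (f , f-injective , f⇔) =
    g , (λ eq → f-injective (trans (sym (ιg _)) (trans (cong ι eq) (ιg _)))) , λ i j → mk⇔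
      (λ a → adj (to (f⇔ i j) a))
      (λ b → from (f⇔ i j) (from (missing⇔ _ _) (g i , g j , b , ιg i , ιg j)))
    where
    preimage : ∀ i → ∃[ a ] ι a ≡ f i
    preimage i with j , ij ← noIso i with a , _ , _ , eq , _ ← to (missing⇔ _ _) (to (f⇔ i j) ij) =
      a , eq

    g = proj₁ ∘ preimage
    ιg = proj₂ ∘ preimage

    adj : ∀ {i j} → Missing D (f i) (f j) → Graph.Adj G (g i) (g j)
    adj {i} {j} m with a , b , ab , ιa , ιb ← to (missing⇔ _ _) m
      with refl ← ι-injective (trans ιa (sym (ιg i)))
      with refl ← ι-injective (trans ιb (sym (ιg j))) = ab

  missing-comb : Comb G → Comb missingGraph
  missing-comb comb = record
    { noC₄      = noC₄ ∘ lift C₄ _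
    ; noCoC₄    = noCoC₄ ∘ lift (complement C₄) _
    ; noC₅      = noC₅ ∘ lift C₅ _
    ; noChair   = noChair ∘ lift chair _
    ; noCoChair = noCoChair ∘ lift (complement chair) _
    }
    where
    open Comb comb
    lift : ∀ H → True (noIsolated? H) → H InducedIn missingGraph → H InducedIn G
    lift H noIso = induced-missing⇒induced {H} (toWitness noIso)

-- Orientations of the complement and their extension from an induced subgraph.

record Orientation (G : Graph) : Set₁ where
  open Graph G
  field
    Arrow       : Rel V 0ℓ
    arrow?      : Decidable Arrow
    asym        : Asymmetric Arrow
    nonadjacent : ∀ {x y} → Arrow x y → ¬ Adj x y
    total       : ∀ {x y} → x ≢ y → ¬ Adj x y → Arrow x y ⊎ Arrow y x

  digraph : OrientedGraph
  digraph = record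
    { order    = order
    ; _⟶_      = Arrow
    ; arc?     = arrow?
    ; loopless = λ { refl a → asym a a }
    ; noDigon  = asym
    }

  missing⇒adj : ∀ {x y} → Missing digraph x y → Adj x y
  missing⇒adj {x} {y} (x≢y , ¬xy , ¬yx) with adj? x y
  ... | yes a = a
  ... | no ¬a = contradiction (total x≢y ¬a) Sum.[ ¬xy , ¬yx ]

  adj⇒missing : ∀ {x y} → Adj x y → Missing digraph x y
  adj⇒missing a =
    (λ x≡y → irrefl x≡y a) , (λ xy → nonadjacent xy a) , (λ yx → nonadjacent yx (symm a))

  misses : digraph Misses G
  misses = id , id , λ x y → mk⇔ (λ m → x , y , missing⇒adj m , refl , refl)
                                  (λ { (_ , _ , a , refl , refl) → adj⇒missing a })

module Extension {H G : Graph} (emb : H InducedIn G) (O : Orientation H) where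
  private
    module H = Graph H
    module G = Graph G
    module O = Orientation O
    f = proj₁ emb
    f-injective = proj₁ (proj₂ emb)
    f⇔ = proj₂ (proj₂ emb)

  Image : G.V → Set
  Image x = ∃[ i ] f i ≡ x

  image? : ∀ x → Dec (Image x)
  image? x = any? λ i → f i ≟ x

  -- Every arc between the copy of H and the other vertices ends in the copy,
  -- so that no new 2-path joins two vertices of the copy.
  data Extended : Rel G.V 0ℓ where
    inside  : ∀ {i j} → O.Arrow i j → Extended (f i) (f j)
    inward  : ∀ {x y} → ¬ G.Adj x y → ¬ Image x → Image y → Extended x y
    outside : ∀ {x y} → ¬ G.Adj x y → ¬ Image x → ¬ Image y → x < y → Extended x y

  -- No arc leaves the copy of `H`: the other two constructors start outside it.
  inside⁻ : ∀ {i y} → Extended (f i) y → ∃[ j ] f j ≡ y × O.Arrow i j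
  inside⁻ {i} e = go e refl
    where
    go : ∀ {x y} → Extended x y → f i ≡ x → ∃[ j ] f j ≡ y × O.Arrow i j
    go (inside {j = j} a) eq with refl ← f-injective eq = j , refl , a
    go (inward _ x∉ _) eq    = contradiction (i , eq) x∉
    go (outside _ x∉ _ _) eq = contradiction (i , eq) x∉

  arrow⁻ : ∀ {i j} → Extended (f i) (f j) → O.Arrow i j
  arrow⁻ e with k , eq , a ← inside⁻ e with refl ← f-injective eq = a

  extended? : Decidable Extended
  extended? x y with image? x | image? y
  ... | yes (i , refl) | yes (j , refl) with O.arrow? i j
  ...   | yes a = yes (inside a)
  ...   | no ¬a = no (¬a ∘ arrow⁻)
  extended? x y | yes (i , refl) | no y∉ = no λ e → let j , eq , _ = inside⁻ e in y∉ (j , eq)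
  extended? x y | no x∉ | yes y∈ with G.adj? x y
  ... | no ¬xy = yes (inward ¬xy x∉ y∈)
  ... | yes xy = no λ
    { (inside a)          → x∉ (_ , refl)
    ; (inward ¬xy _ _)    → ¬xy xy
    ; (outside ¬xy _ _ _) → ¬xy xy
    }
  extended? x y | no x∉ | no y∉ with G.adj? x y | x <? y
  ... | no ¬xy | yes x<y = yes (outside ¬xy x∉ y∉ x<y)
  ... | no _   | no ¬x<y = no λ
    { (inside a)          → x∉ (_ , refl)
    ; (inward _ _ y∈)     → y∉ y∈
    ; (outside _ _ _ x<y) → ¬x<y x<y
    }
  ... | yes xy | _ = no λ
    { (inside a)          → x∉ (_ , refl)
    ; (inward ¬xy _ _)    → ¬xy xy
    ; (outside ¬xy _ _ _) → ¬xy xy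
    }

  extended-asym : Asymmetric Extended
  extended-asym (inside a) e = O.asym a (arrow⁻ e)
  extended-asym (inward _ x∉ y∈) e with _ , refl ← y∈ = let j , eq , _ = inside⁻ e in x∉ (j , eq)
  extended-asym (outside _ x∉ y∉ _) (inside _)          = y∉ (_ , refl)
  extended-asym (outside _ x∉ y∉ _) (inward _ _ x∈)     = x∉ x∈
  extended-asym (outside _ _ _ x<y) (outside _ _ _ y<x) = <-asym x<y y<x

  extended-nonadjacent : ∀ {x y} → Extended x y → ¬ G.Adj x y
  extended-nonadjacent (inside a)          xy = O.nonadjacent a (Equivalence.from (f⇔ _ _) xy)
  extended-nonadjacent (inward ¬xy _ _)    xy = ¬xy xy
  extended-nonadjacent (outside ¬xy _ _ _) xy = ¬xy xy

  extended-total : ∀ {x y} → x ≢ y → ¬ G.Adj x y → Extended x y ⊎ Extended y x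
  extended-total {x} {y} x≢y ¬xy with image? x | image? y
  ... | yes (i , refl) | yes (j , refl) =
    Sum.map inside inside (O.total (x≢y ∘ cong f) (¬xy ∘ Equivalence.to (f⇔ i j)))
  ... | yes x∈ | no y∉  = inj₂ (inward (¬xy ∘ G.symm) y∉ x∈)
  ... | no x∉  | yes y∈ = inj₁ (inward ¬xy x∉ y∈)
  ... | no x∉  | no y∉ with <-cmp x y
  ...   | tri< x<y _ _ = inj₁ (outside ¬xy x∉ y∉ x<y)
  ...   | tri≈ _ x≡y _ = contradiction x≡y x≢y
  ...   | tri> _ _ y<x = inj₂ (outside (¬xy ∘ G.symm) y∉ x∉ y<x)

  extension : Orientation G
  extension = record
    { Arrow       = Extended
    ; arrow?      = extended?
    ; asym        = extended-asym
    ; nonadjacent = extended-nonadjacent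
    ; total       = extended-total
    }

  private
    E = O.digraph
    D = Orientation.digraph extension
    module E = MissingGraph E
    module D = MissingGraph D

  image-edge : (e : MissingEdge E) →
    ∃[ e′ ] HasEnds D e′ (f (MissingEdge.lo e)) (f (MissingEdge.hi e))
  image-edge e = D.edgeBetween _ _
    (Orientation.adj⇒missing extension
      (Equivalence.to (f⇔ _ _) (O.missing⇒adj (MissingEdge.missing e))))

  mapEdge : MissingEdge E → MissingEdge D
  mapEdge = proj₁ ∘ image-edge

  mapEdge-ends : ∀ {e x y} → HasEnds E e x y → HasEnds D (mapEdge e) (f x) (f y)
  mapEdge-ends {e} (inj₁ (refl , refl)) = proj₂ (image-edge e)
  mapEdge-ends {e} (inj₂ (refl , refl)) = Sum.swap (proj₂ (image-edge e))

  mapEdge-injective : ∀ {e e′} → mapEdge e ≡ mapEdge e′ → e ≡ e′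
  mapEdge-injective {e} {e′} eq =
    E.edge-unique (inj₁ (refl , refl))
      (ends (D.ends-unique {mapEdge e′} (proj₂ (image-edge e′))
              (subst (λ e″ → HasEnds D e″ _ _) eq (proj₂ (image-edge e)))))
    where
    open MissingEdge
    ends : (f (lo e′) , f (hi e′)) ≡ (f (lo e) , f (hi e)) ⊎ (f (hi e′) , f (lo e′)) ≡ (f (lo e) , f (hi e)) →
      HasEnds E e′ (lo e) (hi e)
    ends (inj₁ p) = inj₁ (f-injective (cong proj₁ p) , f-injective (cong proj₂ p))
    ends (inj₂ p) = inj₂ (f-injective (cong proj₂ p) , f-injective (cong proj₁ p))

  mapEdge-losesTo : ∀ {e e′} → LosesTo E e e′ → LosesTo D (mapEdge e) (mapEdge e′)
  mapEdge-losesTo {e} {e′} (x₁ , y₁ , x₂ , y₂ , ends , ends′ , a , far , b , far′) =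
    f x₁ , f y₁ , f x₂ , f y₂ , mapEdge-ends {e} ends , mapEdge-ends {e′} ends′ ,
    inside a , far ∘ near , inside b , far′ ∘ near
    where
    near : ∀ {x y} → N⁺ D (f x) (f y) ⊎ N⁺⁺ D (f x) (f y) → N⁺ E x y ⊎ N⁺⁺ E x y
    near (inj₁ xy) = inj₁ (arrow⁻ xy)
    -- The midpoint `z` cannot be outside the copy, so the 2-path pulls back to `E`.
    near (inj₂ (¬xy , z , xz , zy)) with k , refl , xk ← inside⁻ xz =
      inj₂ (¬xy ∘ inside , k , xk , arrow⁻ zy)

  -- `mapEdge` embeds one dependency digraph in the other, and the three conditions pass to
  -- subdigraphs.
  extension-linear : Linear (Δ D) → Linear (Δ E)
  extension-linear lin = record
    { functional = λ {u} {v} {w} a b → mapEdge-injective {v} {w}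
        (functional {mapEdge u} (mapEdge-losesTo {u} {v} a) (mapEdge-losesTo {u} {w} b))
    ; injective  = λ {u} {v} {w} a b → mapEdge-injective {u} {v}
        (injective {w = mapEdge w} (mapEdge-losesTo {u} {w} a) (mapEdge-losesTo {v} {w} b))
    ; asym       = λ {u} {v} a b → asym {mapEdge u} {mapEdge v} (mapEdge-losesTo {u} {v} a) (mapEdge-losesTo {v} {u} b)
    }
    where open Linear lin

𝓕𝒫⃗⇒Linear : ∀ {G H} → G ∈ 𝓕 𝒫⃗ → H InducedIn G →
  (O : Orientation H) → Linear (Δ (Orientation.digraph O))
𝓕𝒫⃗⇒Linear {G} {H} G∈ emb O = extension-linear
  (𝒫⃗⇒Linear (G∈ (Orientation.digraph extension) (Orientation.misses extension)))
  where open Extension {H} {G} emb O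

-- Explicit orientations for the forbidden subgraphs, checked by evaluation.

module _ (H : Graph) where
  open Graph H
  open DecMembership (≡-dec (_≟_ {order}) (_≟_ {order})) using (_∈?_)

  Orients : List (V × V) → Set
  Orients as = (∀ x y → (x , y) ∈ₗ as → ¬ (y , x) ∈ₗ as × ¬ Adj x y)
             × (∀ x y → x ≢ y × ¬ Adj x y → (x , y) ∈ₗ as ⊎ (y , x) ∈ₗ as)

  orients? : ∀ as → Dec (Orients as)
  orients? as =
    (all? λ x → all? λ y → (x , y) ∈? as →-dec (¬? ((y , x) ∈? as) ×-dec ¬? (adj? x y)))
    ×-dec
    (all? λ x → all? λ y → (¬? (x ≟ y) ×-dec ¬? (adj? x y)) →-dec ((x , y) ∈? as ⊎-dec (y , x) ∈? as))

  orientation : ∀ as → {True (orients? as)} → Orientation H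
  orientation as {ok} = record
    { Arrow       = λ x y → (x , y) ∈ₗ as
    ; arrow?      = λ x y → (x , y) ∈? as
    ; asym        = λ xy → proj₁ (proj₁ (toWitness ok) _ _ xy)
    ; nonadjacent = λ xy → proj₂ (proj₁ (toWitness ok) _ _ xy)
    ; total       = λ x≢y ¬xy → proj₂ (toWitness ok) _ _ (x≢y , ¬xy)
    }

module _ (D : OrientedGraph) where
  open OrientedGraph D
  open MissingGraph D

  edge : ∀ x y → {True (x <? y)} → {True (missing? x y)} → MissingEdge D
  edge x y {x<y} {m} = missingEdge x y (toWitness x<y) (toWitness m)

  loses : ∀ e e′ → {True (losesTo? e e′)} → LosesTo D e e′
  loses e e′ {l} = toWitness l

-- The edges {0,2} and {1,3} of the orientation 0 → 1 → 2 → 3 → 0 form a digon.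
co-C₄-orientation : Orientation (complement C₄)
co-C₄-orientation = orientation (complement C₄) ((0F , 1F) ∷ (1F , 2F) ∷ (2F , 3F) ∷ (3F , 0F) ∷ [])

co-C₄-nonlinear : ¬ Linear (Δ (Orientation.digraph co-C₄-orientation))
co-C₄-nonlinear lin = Linear.asym lin {e} {e′} (loses D e e′) (loses D e′ e)
  where
  D = Orientation.digraph co-C₄-orientation
  e = edge D 0F 2F
  e′ = edge D 1F 3F

-- The edge {0,1} loses to both {2,3} and {2,4}: from 0 only the sink 2 is reached, and from 1 two
-- steps lead to 3, 4 and 0 but not to 2.
chair-orientation : Orientation chair
chair-orientation = orientation chair
  ((0F , 2F) ∷ (1F , 3F) ∷ (1F , 4F) ∷ (3F , 0F) ∷ (4F , 0F) ∷ (3F , 4F) ∷ [])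

chair-nonlinear : ¬ Linear (Δ (Orientation.digraph chair-orientation))
chair-nonlinear lin = distinct (Linear.functional lin {e} {e₁} {e₂} (loses D e e₁) (loses D e e₂))
  where
  D = Orientation.digraph chair-orientation
  e = edge D 0F 1F
  e₁ = edge D 2F 3F
  e₂ = edge D 2F 4F
  distinct : e₁ ≢ e₂
  distinct ()

-- Both {1,3} and {1,4} lose to {0,2}: from 1 only the sink 0 is reached, and 3 and 4 reach 0 only
-- after three steps, through 2 and 1.
coChair-orientation : Orientation (complement chair)
coChair-orientation = orientation (complement chair)
  ((1F , 0F) ∷ (2F , 1F) ∷ (3F , 2F) ∷ (4F , 2F) ∷ [])

coChair-nonlinear : ¬ Linear (Δ (Orientation.digraph coChair-orientation))
coChair-nonlinear lin = distinct (Linear.injective lin {e₁} {e₂} {e} (loses D e₁ e) (loses D e₂ e))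
  where
  D = Orientation.digraph coChair-orientation
  e₁ = edge D 1F 3F
  e₂ = edge D 1F 4F
  e = edge D 0F 2F
  distinct : e₁ ≢ e₂
  distinct ()

theorem6 : (G : Graph) → ¬ (C₄ InducedIn G) → ¬ (C₅ InducedIn G) →
    (G ∈ 𝓕 𝒫⃗) ⇔ Comb G
theorem6 G noC₄ noC₅ = mk⇔
  (λ G∈ → record
    { noC₄      = noC₄
    ; noCoC₄    = λ emb → co-C₄-nonlinear (𝓕𝒫⃗⇒Linear {G} G∈ emb co-C₄-orientation)
    ; noC₅      = noC₅
    ; noChair   = λ emb → chair-nonlinear (𝓕𝒫⃗⇒Linear {G} G∈ emb chair-orientation)
    ; noCoChair = λ emb → coChair-nonlinear (𝓕𝒫⃗⇒Linear {G} G∈ emb coChair-orientation)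
    })
  (λ comb D misses → CombDependency.Δ-paths D (missing-comb {D} {G} misses comb))
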